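{- The number of order-different additive ($1$-XOS) functions on $V=[n]$ (i.e., the number of order-equivalence classes of additive functions $f\colon 2^{[n]}\to\mathbb{R}$) is $2^{\Omega(n^2)}$.
   Context: A set function $f\colon 2^V\to\mathbb{R}$ is additive if $f(X)=\sum_{v\in X}f(\{v\})$ for all $X\subseteq V$ (values may be negative). Two set functions $f,g\colon 2^V\to\mathbb{R}$ are order-equivalent if for all $X,Y\subseteq V$, $f(X)\le f(Y)$ if and only if $g(X)\le g(Y)$; otherwise they are order-different. -}

module Defs where

open import Data.Bool.Base using (true; false)
open import Data.Fin.Base using (Fin; zero; suc)
open import Data.Fin.Subset using (Subset; ⁅_⁆)
open import Data.Nat.Base as ℕ using (ℕ; zero; suc)
import Data.Nat.Properties as ℕ
open import Data.Product.Base using (Σ; ∃-syntax; _×_; _,_; proj₁)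
open import Data.Rational using (ℚ; 0ℚ; ½; ∣_∣)
import Data.Rational as ℚ
import Data.Rational.Properties as ℚ
open import Data.Rational.Solver using (module +-*-Solver)
open import Data.Vec.Base using ([]; _∷_)
open import Function.Base using (_∘_)
open import Function.Bundles using (_⇔_; Injection)
open import Function.Construct.Composition using (_⇔-∘_)
open import Function.Construct.Identity using (⇔-id)
open import Function.Construct.Symmetry using (⇔-sym)
open import Level using (Level; 0ℓ; _⊔_)
open import Relation.Binary.Bundles using (Setoid)
open import Relation.Binary.PropositionalEquality as ≡
  using (_≡_; refl; sym; cong; subst; subst₂)

-- The real numbers, as Cauchy sequences of rationals.  The quotient is not
-- formed: _≃_ is the equality of real numbers.

IsCauchy : (ℕ → ℚ) → Set
IsCauchy x = ∀ ε → 0ℚ ℚ.< ε →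
  ∃[ N ] (∀ m n → N ℕ.≤ m → N ℕ.≤ n → ∣ x m ℚ.- x n ∣ ℚ.< ε)

record ℝ : Set where
  constructor mkℝ
  field
    approx : ℕ → ℚ
    cauchy : IsCauchy approx

open ℝ public

infix 4 _≤_ _≃_
infixl 6 _+_

_≤_ : ℝ → ℝ → Set
x ≤ y = ∀ ε → 0ℚ ℚ.< ε →
  ∃[ N ] (∀ n → N ℕ.≤ n → approx x n ℚ.< approx y n ℚ.+ ε)

_≃_ : ℝ → ℝ → Set
x ≃ y = ∀ ε → 0ℚ ℚ.< ε →
  ∃[ N ] (∀ n → N ℕ.≤ n → ∣ approx x n ℚ.- approx y n ∣ ℚ.< ε)

fromℚ : ℚ → ℝ
fromℚ q = mkℝ (λ _ → q) λ ε 0<ε → 0 , λ _ _ _ _ →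
  subst (ℚ._< ε) (sym (cong ∣_∣ (ℚ.+-inverseʳ q))) 0<ε

0ℝ : ℝ
0ℝ = fromℚ 0ℚ

private
  ½*-pos : ∀ ε → 0ℚ ℚ.< ε → 0ℚ ℚ.< ½ ℚ.* ε
  ½*-pos ε 0<ε = subst (ℚ._< ½ ℚ.* ε) (ℚ.*-zeroʳ ½) (ℚ.*-monoʳ-<-pos ½ 0<ε)

  ½+½ : ∀ ε → ½ ℚ.* ε ℚ.+ ½ ℚ.* ε ≡ ε
  ½+½ ε = ≡.trans (sym (ℚ.*-distribʳ-+ ε ½ ½)) (ℚ.*-identityˡ ε)

  interchange : ∀ a b c d →
    (a ℚ.- c) ℚ.+ (b ℚ.- d) ≡ (a ℚ.+ b) ℚ.- (c ℚ.+ d)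
  interchange = solve 4
    (λ a b c d → (a :- c) :+ (b :- d) := (a :+ b) :- (c :+ d)) refl
    where open +-*-Solver

_+_ : ℝ → ℝ → ℝ
x + y = mkℝ (λ n → approx x n ℚ.+ approx y n) λ ε 0<ε →
  let (M , p) = cauchy x (½ ℚ.* ε) (½*-pos ε 0<ε)
      (N , q) = cauchy y (½ ℚ.* ε) (½*-pos ε 0<ε)
  in M ℕ.⊔ N , λ m n M⊔N≤m M⊔N≤n →
    subst₂ ℚ._<_
      (cong ∣_∣ (interchange (approx x m) (approx y m) (approx x n) (approx y n)))
      (½+½ ε)
      (ℚ.≤-<-trans
        (ℚ.∣p+q∣≤∣p∣+∣q∣ (approx x m ℚ.- approx x n) (approx y m ℚ.- approx y n))
        (ℚ.+-mono-<
          (p m n (ℕ.m⊔n≤o⇒m≤o M N M⊔N≤m) (ℕ.m⊔n≤o⇒m≤o M N M⊔N≤n))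
          (q m n (ℕ.m⊔n≤o⇒n≤o M N M⊔N≤m) (ℕ.m⊔n≤o⇒n≤o M N M⊔N≤n))))

SetFunction : ℕ → Set
SetFunction n = Subset n → ℝ

sumOver : ∀ {n} → Subset n → (Fin n → ℝ) → ℝ
sumOver []          g = 0ℝ
sumOver (true  ∷ X) g = g zero + sumOver X (g ∘ suc)
sumOver (false ∷ X) g = sumOver X (g ∘ suc)

Additive : ∀ {n} → SetFunction n → Set
Additive f = ∀ X → f X ≃ sumOver X (λ v → f ⁅ v ⁆)

OrderEquivalent : ∀ {n} → SetFunction n → SetFunction n → Set
OrderEquivalent f g = ∀ X Y → (f X ≤ f Y) ⇔ (g X ≤ g Y)

AdditiveFunctions : ℕ → Setoid 0ℓ 0ℓ
AdditiveFunctions n = record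
  { Carrier       = Σ (SetFunction n) Additive
  ; _≈_           = λ f g → OrderEquivalent (proj₁ f) (proj₁ g)
  ; isEquivalence = record
    { refl  = λ X Y → ⇔-id _
    ; sym   = λ f∼g X Y → ⇔-sym (f∼g X Y)
    ; trans = λ f∼g g∼h X Y → g∼h X Y ⇔-∘ f∼g X Y
    }
  }

-- The number of equivalence classes of S is at least m: there are m
-- elements of S, no two of which (at different indices) are equivalent.
AtLeast_ClassesIn_ : ∀ {a ℓ : Level} → ℕ → Setoid a ℓ → Set (a ⊔ ℓ)
AtLeast m ClassesIn S = Injection (≡.setoid (Fin m)) S

-- F is 2^Ω(h): F n ≥ 2 ^ (c · h n) for all n ≥ n₀, with a constant c > 0.
-- Any such real c can be lowered to a positive rational p / q, and the
-- inequality is then stated after raising both sides to the power q.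
_∈2^Ω_ : (F h : ℕ → ℕ) → Set
F ∈2^Ω h = ∃[ p ] ∃[ q ] ∃[ n₀ ] (0 ℕ.< p × 0 ℕ.< q ×
  (∀ n → n₀ ℕ.≤ n → 2 ℕ.^ (p ℕ.* h n) ℕ.≤ F n ℕ.^ q))

-- Give k elements the weights 2^(k-1), …, 2, 1, so that every number below 2^k
-- is the weight of some set of them, and give the other l elements arbitrary
-- weights below 2^k.  Comparing each of the latter with the sets of powers of
-- two recovers its weight from the order alone, so these (2^k)^l weightings are
-- pairwise order-different; take k = ⌊n/2⌋ and l = ⌈n/2⌉.

{-# OPTIONS --safe #-}
module Submission where

open import Defs
open import Data.Bool.Base using (true; false)
open import Data.Fin.Base using (Fin; zero; suc; toℕ; combine; finToFun; funToFin; _↑ʳ_)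
open import Data.Fin.Properties
  using (toℕ-injective; toℕ-combine; combine-surjective; funToFin-finToFin)
open import Data.Fin.Subset using (Subset; ⁅_⁆; ⊥)
open import Data.Nat.Base as ℕ using (ℕ; zero; suc; _^_; z≤n; s≤s; z<s; ⌊_/2⌋; ⌈_/2⌉)
import Data.Nat.Properties as ℕ
open import Data.Nat.Tactic.RingSolver using (solve-∀)
open import Data.Product.Base using (∃-syntax; _×_; _,_)
open import Data.Rational as ℚ using (ℚ; 0ℚ; 1ℚ)
import Data.Rational.Properties as ℚ
open import Algebra.Properties.Monoid.Mult ℚ.+-0-monoid using (×-homo-+) renaming (_×_ to _·_)
open import Data.Vec.Base using (Vec; []; _∷_; _++_; lookup; tabulate)
open import Data.Vec.Properties using (lookup∘tabulate; lookup-++ʳ)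
open import Function.Base using (_∘_)
open import Function.Bundles using (_⇔_; mk⇔; module Equivalence)
open import Function.Construct.Identity using (⇔-id)
open import Function.Construct.Symmetry using (⇔-sym)
open import Relation.Binary.PropositionalEquality

private variable
  k l n : ℕ

fromℚ-mono-≤ : ∀ {p q} → p ℚ.≤ q → fromℚ p ≤ fromℚ q
fromℚ-mono-≤ {p} p≤q ε 0<ε = 0 , λ _ _ →
  subst (ℚ._< _) (ℚ.+-identityʳ p) (ℚ.+-mono-≤-< p≤q 0<ε)

fromℚ-cancel-≤ : ∀ {p q} → fromℚ p ≤ fromℚ q → p ℚ.≤ q
fromℚ-cancel-≤ {p} {q} p≤q = ℚ.≮⇒≥ λ q<p →
  -- The gap `p - q` is positive when `q < p`. Taken as the slack, it turns the bound on `p` into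
  -- `p < p`.
  let N , p<q+ε = p≤q (p ℚ.- q) (subst (ℚ._< p ℚ.- q) (ℚ.+-inverseʳ q) (ℚ.+-monoˡ-< (ℚ.- q) q<p))
  in ℚ.<-irrefl refl (subst (p ℚ.<_) q+[p-q]≡p (p<q+ε N ℕ.≤-refl))
  where
  open ≡-Reasoning
  q+[p-q]≡p : q ℚ.+ (p ℚ.- q) ≡ p
  q+[p-q]≡p = begin
    q ℚ.+ (p ℚ.- q)     ≡⟨ ℚ.+-comm q _ ⟩
    p ℚ.- q ℚ.+ q       ≡⟨ ℚ.+-assoc p _ q ⟩
    p ℚ.+ (ℚ.- q ℚ.+ q) ≡⟨ cong (p ℚ.+_) (ℚ.+-inverseˡ q) ⟩
    p ℚ.+ 0ℚ            ≡⟨ ℚ.+-identityʳ p ⟩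
    p                   ∎

≡⇒≃ : ∀ {x y} → (∀ m → approx x m ≡ approx y m) → x ≃ y
≡⇒≃ {x} {y} x≡y ε 0<ε = 0 , λ m _ →
  subst (λ q → ℚ.∣ q ∣ ℚ.< ε)
    (sym (trans (cong (ℚ._- approx y m) (x≡y m)) (ℚ.+-inverseʳ (approx y m)))) 0<ε

-- As an iterated sum of `1ℚ` it unfolds at `suc`, which drives the inductions on the order, and
-- `×-homo-+` makes it additive.
fromℕ : ℕ → ℚ
fromℕ m = m · 1ℚ

fromℕ-mono-≤ : ∀ {i j} → i ℕ.≤ j → fromℕ i ℚ.≤ fromℕ j
fromℕ-mono-≤ {j = zero}  z≤n       = ℚ.≤-refl
-- The left side `0ℚ` is met as `0ℚ ℚ.+ 0ℚ`, which computes to it.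
fromℕ-mono-≤ {j = suc j} z≤n       = ℚ.+-mono-≤ (ℚ.nonNegative⁻¹ 1ℚ) (fromℕ-mono-≤ {j = j} z≤n)
fromℕ-mono-≤             (s≤s i≤j) = ℚ.+-monoʳ-≤ 1ℚ (fromℕ-mono-≤ i≤j)

fromℕ-mono-< : ∀ {i j} → i ℕ.< j → fromℕ i ℚ.< fromℕ j
fromℕ-mono-< {i} i<j = ℚ.<-≤-trans
  (subst (ℚ._< fromℕ (suc i)) (ℚ.+-identityˡ _) (ℚ.+-monoˡ-< (fromℕ i) (ℚ.positive⁻¹ 1ℚ)))
  (fromℕ-mono-≤ i<j)

fromℕ-cancel-≤ : ∀ {i j} → fromℕ i ℚ.≤ fromℕ j → i ℕ.≤ j
fromℕ-cancel-≤ i≤j = ℕ.≮⇒≥ λ j<i →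
  ℚ.<-irrefl refl (ℚ.<-≤-trans (fromℕ-mono-< j<i) i≤j)

weight : Vec ℕ n → Subset n → ℕ
weight []       []          = 0
weight (w ∷ ws) (true  ∷ X) = w ℕ.+ weight ws X
weight (w ∷ ws) (false ∷ X) = weight ws X

weight-⊥ : (ws : Vec ℕ n) → weight ws ⊥ ≡ 0
weight-⊥ []       = refl
weight-⊥ (w ∷ ws) = weight-⊥ ws

weight-⁅⁆ : (ws : Vec ℕ n) (v : Fin n) → weight ws ⁅ v ⁆ ≡ lookup ws v
weight-⁅⁆ (w ∷ ws) zero    = trans (cong (w ℕ.+_) (weight-⊥ ws)) (ℕ.+-identityʳ w)
weight-⁅⁆ (w ∷ ws) (suc v) = weight-⁅⁆ ws v

-- A set that avoids the last elements does not see their weights, so one test set keeps its weight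
-- throughout the family of weightings.
weight-++-⊥ : (us : Vec ℕ k) (ws : Vec ℕ l) (X : Subset k) →
  weight (us ++ ws) (X ++ ⊥) ≡ weight us X
weight-++-⊥ []       ws []          = weight-⊥ ws
weight-++-⊥ (u ∷ us) ws (true  ∷ X) = cong (u ℕ.+_) (weight-++-⊥ us ws X)
weight-++-⊥ (u ∷ us) ws (false ∷ X) = weight-++-⊥ us ws X

weightFunction : Vec ℕ n → SetFunction n
weightFunction ws X = fromℚ (fromℕ (weight ws X))

-- Addition of reals is termwise, so at a fixed index `m` the real sum is a sum of rationals, and
-- additivity needs no limit argument.
approx-sumOver : ∀ m (ws : Vec ℕ n) X g → (∀ v → approx (g v) m ≡ fromℕ (lookup ws v)) →
  approx (sumOver X g) m ≡ fromℕ (weight ws X)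
approx-sumOver m []       []          g g≡w = refl
approx-sumOver m (w ∷ ws) (true  ∷ X) g g≡w = trans
  (cong₂ ℚ._+_ (g≡w zero) (approx-sumOver m ws X (g ∘ suc) (g≡w ∘ suc)))
  (sym (×-homo-+ 1ℚ w (weight ws X)))
approx-sumOver m (w ∷ ws) (false ∷ X) g g≡w = approx-sumOver m ws X (g ∘ suc) (g≡w ∘ suc)

weightFunction-additive : (ws : Vec ℕ n) → Additive (weightFunction ws)
weightFunction-additive ws X = ≡⇒≃ {weightFunction ws X} {sumOver X (weightFunction ws ∘ ⁅_⁆)} λ m →
  sym (approx-sumOver m ws X _ (cong fromℕ ∘ weight-⁅⁆ ws))

weightFunction-≤ : (ws : Vec ℕ n) (X Y : Subset n) →
  (weightFunction ws X ≤ weightFunction ws Y) ⇔ (weight ws X ℕ.≤ weight ws Y)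
weightFunction-≤ ws X Y =
  mk⇔ (fromℕ-cancel-≤ ∘ fromℚ-cancel-≤) (fromℚ-mono-≤ ∘ fromℕ-mono-≤)

OrderEquivalent⇒weight-≤ : (us ws : Vec ℕ n) →
  OrderEquivalent (weightFunction us) (weightFunction ws) →
  ∀ X Y → weight us X ℕ.≤ weight us Y → weight ws X ℕ.≤ weight ws Y
OrderEquivalent⇒weight-≤ us ws us∼ws X Y =
  to (weightFunction-≤ ws X Y) ∘ to (us∼ws X Y) ∘ from (weightFunction-≤ us X Y)
  where open Equivalence

powers : ∀ k → Vec ℕ k
powers zero    = []
powers (suc k) = 2 ^ k ∷ powers k

-- Induction on binary digits, leading digit first: `combine-surjective` splits `x` into that digit
-- and a remainder `y` below `2 ^ k`, and the digit decides whether the head of `powers (suc k)` is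
-- taken.
binary : ∀ k (x : Fin (2 ^ k)) → ∃[ X ] weight (powers k) X ≡ toℕ x
binary zero    zero = [] , refl
binary (suc k) x with combine-surjective {2} {2 ^ k} x
... | zero , y , refl = let X , eq = binary k y in
  false ∷ X , trans eq (sym (trans (toℕ-combine {2} zero y) (cong (ℕ._+ toℕ y) (ℕ.*-zeroʳ (2 ^ k)))))
... | suc zero , y , refl = let X , eq = binary k y in
  true ∷ X , trans (cong (2 ^ k ℕ.+_) eq)
    (sym (trans (toℕ-combine {2} (suc zero) y) (cong (ℕ._+ toℕ y) (ℕ.*-identityʳ (2 ^ k)))))

weights : ∀ k → (Fin l → Fin (2 ^ k)) → Vec ℕ (k ℕ.+ l)
weights k a = powers k ++ tabulate (toℕ ∘ a)

weight-weights-⁅⁆ : ∀ k (a : Fin l → Fin (2 ^ k)) (i : Fin l) →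
  weight (weights k a) ⁅ k ↑ʳ i ⁆ ≡ toℕ (a i)
weight-weights-⁅⁆ k a i = begin
  weight (weights k a) ⁅ k ↑ʳ i ⁆ ≡⟨ weight-⁅⁆ (weights k a) (k ↑ʳ i) ⟩
  lookup (weights k a) (k ↑ʳ i)   ≡⟨ lookup-++ʳ (powers k) _ i ⟩
  lookup (tabulate (toℕ ∘ a)) i   ≡⟨ lookup∘tabulate (toℕ ∘ a) i ⟩
  toℕ (a i)                       ∎
  where open ≡-Reasoning

-- The test pair for i is the singleton of the i-th free element against the set
-- of powers of two of weight b i; under b itself the two sides are equal.
weights-reflect-≤ : ∀ k (a b : Fin l → Fin (2 ^ k)) →
  OrderEquivalent (weightFunction (weights k a)) (weightFunction (weights k b)) →
  ∀ i → toℕ (a i) ℕ.≤ toℕ (b i)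
weights-reflect-≤ k a b a∼b i with binary k (b i)
... | X , X≡bᵢ = subst₂ ℕ._≤_
  (weight-weights-⁅⁆ k a i) (weight-X a)
  (OrderEquivalent⇒weight-≤ (weights k b) (weights k a)
    (λ X Y → ⇔-sym (a∼b X Y)) _ _
    (ℕ.≤-reflexive (trans (weight-weights-⁅⁆ k b i) (sym (weight-X b)))))
  where
  weight-X : ∀ c → weight (weights k c) (X ++ ⊥) ≡ toℕ (b i)
  weight-X c = trans (weight-++-⊥ (powers k) _ X) X≡bᵢ

-- The tests for `b` bound `a i` from above; exchanging the roles of `a` and `b` gives the reverse
-- bound.
weights-injective : ∀ k (a b : Fin l → Fin (2 ^ k)) →
  OrderEquivalent (weightFunction (weights k a)) (weightFunction (weights k b)) →
  ∀ i → a i ≡ b i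
weights-injective k a b a∼b i = toℕ-injective (ℕ.≤-antisym
  (weights-reflect-≤ k a b a∼b i)
  (weights-reflect-≤ k b a (λ X Y → ⇔-sym (a∼b X Y)) i))

funToFin-cong : ∀ {m} {f g : Fin n → Fin m} → (∀ i → f i ≡ g i) → funToFin f ≡ funToFin g
funToFin-cong {zero}  f≗g = refl
funToFin-cong {suc n} f≗g = cong₂ combine (f≗g zero) (funToFin-cong (f≗g ∘ suc))

-- `funToFin` is a left inverse of `finToFun`. The decoded functions agree only pointwise, so
-- `funToFin` has to respect pointwise equality.
finToFun-injective : ∀ {m} {x y : Fin (m ^ n)} →
  (∀ i → finToFun {m} {n} x i ≡ finToFun y i) → x ≡ y
finToFun-injective {n} {m} {x} {y} eq = begin
  x                                ≡⟨ funToFin-finToFin {n} {m} x ⟨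
  funToFin (finToFun {m} {n} x)    ≡⟨ funToFin-cong eq ⟩
  funToFin (finToFun {m} {n} y)    ≡⟨ funToFin-finToFin {n} {m} y ⟩
  y                                ∎
  where open ≡-Reasoning

-- An index below `(2 ^ k) ^ l` codes the `l` free weights as its digits in base `2 ^ k`.
manyClasses : ∀ k l → AtLeast ((2 ^ k) ^ l) ClassesIn (AdditiveFunctions (k ℕ.+ l))
manyClasses k l = record
  { to        = λ x → weightFunction (ws x) , weightFunction-additive (ws x)
  ; cong      = λ { refl X Y → ⇔-id _ }
  ; injective = λ x∼y → finToFun-injective {l} (weights-injective k _ _ x∼y)
  }
  where
  ws : Fin ((2 ^ k) ^ l) → Vec ℕ (k ℕ.+ l)
  ws x = weights k (finToFun x)

classes : ℕ → ℕ
classes n = (2 ^ ⌊ n /2⌋) ^ ⌈ n /2⌉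

-- The 6 is 3 times 2: twice the ceiling reaches `n`, but for odd `n` the floor may need the factor
-- 3, as at `n = 3`.
n²≤⌊n/2⌋*⌈n/2⌉*6 : 2 ℕ.≤ n → n ^ 2 ℕ.≤ ⌊ n /2⌋ ℕ.* ⌈ n /2⌉ ℕ.* 6
n²≤⌊n/2⌋*⌈n/2⌉*6 {n} 2≤n = begin
  n ^ 2                             ≡⟨ cong (n ℕ.*_) (ℕ.*-identityʳ n) ⟩
  n ℕ.* n                           ≤⟨ ℕ.*-mono-≤ n≤3h n≤2c ⟩
  (h ℕ.+ (h ℕ.+ h)) ℕ.* (c ℕ.+ c)   ≡⟨ expand h c ⟩
  h ℕ.* c ℕ.* 6                     ∎
  where
  open ℕ.≤-Reasoning
  h = ⌊ n /2⌋
  c = ⌈ n /2⌉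
  n≤2c : n ℕ.≤ c ℕ.+ c
  n≤2c = ℕ.≤-trans (ℕ.≤-reflexive (sym (ℕ.⌊n/2⌋+⌈n/2⌉≡n n))) (ℕ.+-monoˡ-≤ c (ℕ.⌊n/2⌋≤⌈n/2⌉ n))
  c≤2h : c ℕ.≤ h ℕ.+ h
  -- The middle term is `1 + h`, the floor of half of `n + 2`; then `1 ≤ h` because `2 ≤ n`.
  c≤2h = ℕ.≤-trans (ℕ.⌊n/2⌋-mono (ℕ.n≤1+n (suc n))) (ℕ.+-monoˡ-≤ h (ℕ.⌊n/2⌋-mono 2≤n))
  n≤3h : n ℕ.≤ h ℕ.+ (h ℕ.+ h)
  n≤3h = ℕ.≤-trans (ℕ.≤-reflexive (sym (ℕ.⌊n/2⌋+⌈n/2⌉≡n n))) (ℕ.+-monoʳ-≤ h c≤2h)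
  expand : ∀ h c → (h ℕ.+ (h ℕ.+ h)) ℕ.* (c ℕ.+ c) ≡ h ℕ.* c ℕ.* 6
  expand = solve-∀

classes-growth : classes ∈2^Ω (λ n → n ^ 2)
-- The exponent constant is 1/6, valid from `n = 2` on, where the floor becomes positive.
classes-growth = 1 , 6 , 2 , z<s , z<s , λ n 2≤n → begin
  2 ^ (1 ℕ.* n ^ 2)                     ≡⟨ cong (2 ^_) (ℕ.*-identityˡ (n ^ 2)) ⟩
  2 ^ (n ^ 2)                           ≤⟨ ℕ.^-monoʳ-≤ 2 (n²≤⌊n/2⌋*⌈n/2⌉*6 2≤n) ⟩
  2 ^ (⌊ n /2⌋ ℕ.* ⌈ n /2⌉ ℕ.* 6)       ≡⟨ ℕ.^-*-assoc 2 (⌊ n /2⌋ ℕ.* ⌈ n /2⌉) 6 ⟨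
  (2 ^ (⌊ n /2⌋ ℕ.* ⌈ n /2⌉)) ^ 6       ≡⟨ cong (_^ 6) (ℕ.^-*-assoc 2 ⌊ n /2⌋ ⌈ n /2⌉) ⟨
  classes n ^ 6                         ∎
  where open ℕ.≤-Reasoning

theorem23 : ∃[ F ] ((∀ (n : ℕ) → AtLeast (F n) ClassesIn (AdditiveFunctions n))
    × (F ∈2^Ω (λ n → n ^ 2)))
theorem23 = classes , (λ n → subst (AtLeast classes n ClassesIn_ ∘ AdditiveFunctions)
    (ℕ.⌊n/2⌋+⌈n/2⌉≡n n) (manyClasses ⌊ n /2⌋ ⌈ n /2⌉)) , classes-growth
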